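{- Let $n\ge 1$ and let $\mathcal{I}$ be an interval hypergraph on $[n]$ containing all singletons. Then $P_{\mathcal{I}}$ is a distributive lattice if and only if for all $I,J\in\mathcal{I}$ such that $I\not\subseteq J$, $I\not\supseteq J$ and $I\cap J\neq\varnothing$, the intersection $I\cap J$ belongs to $\mathcal{I}$ and is an initial or a final subinterval of every $K\in\mathcal{I}$ with $I\cap J\subseteq K$ (i.e. $\min(I\cap J)=\min K$ or $\max(I\cap J)=\max K$).
   Context: A hypergraph $\mathcal{H}$ on $[n]=\{1,\dots,n\}$ is a collection of subsets of $[n]$; by convention it contains all singletons. An interval hypergraph is a hypergraph all of whose members are intervals $[i,j]=\{i,\dots,j\}$. An orientation of $\mathcal{H}$ is a map $O:\mathcal{H}\to[n]$ with $O(H)\in H$ for all $H$. It is acyclic if there are no $H_1,\dots,H_k\in\mathcal{H}$, $k\ge2$, with $O(H_{i+1})\in H_i\setminus\{O(H_i)\}$ for $i\in[k-1]$ and $O(H_1)\in H_k\setminus\{O(H_k)\}$. Two orientations $O\neq O'$ are related by an increasing flip (from $O$ to $O'$) if there exist $1\le i<j\le n$ such that for all $H\in\mathcal{H}$: if $O(H)\ne O'(H)$ then $O(H)=i$ and $O'(H)=j$; and if $\{i,j\}\subseteq H$ then $O(H)=i\iff O'(H)=j$. The hypergraphic poset $P_{\mathcal{H}}$ is the transitive closure of the increasing flip relation on the set of acyclic orientations of $\mathcal{H}$. -}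

module Defs where

open import Data.Bool.Base using (Bool; T)
open import Data.Fin.Base using (Fin; zero; suc; inject₁; fromℕ; _≤_; _<_)
open import Data.Fin.Subset using (Subset; _∈_; _⊆_; _⊈_; _⊉_; _∩_; ⁅_⁆; _-_; Nonempty)
open import Data.Nat.Base using (ℕ) renaming (_+_ to _+ℕ_)
open import Data.Product.Base using (∃; ∃₂; ∃-syntax; _×_)
open import Data.Sum.Base using (_⊎_)
open import Function.Bundles using (_⇔_)
open import Level using (0ℓ)
open import Relation.Binary.Core using (Rel)
open import Relation.Binary.Construct.Closure.Transitive using (TransClosure)
import Relation.Binary.Construct.StrictToNonStrict as StrictToNonStrict
open import Relation.Binary.Lattice.Structures using (IsDistributiveLattice)
open import Relation.Binary.PropositionalEquality.Core using (_≡_; _≢_)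
open import Relation.Nullary.Negation.Core using (¬_)

-- The ground set [n] is Fin n.  A collection of subsets of a finite set is
-- given by its characteristic function.
record Hypergraph (n : ℕ) : Set where
  field
    member     : Subset n → Bool
    singletons : ∀ i → T (member ⁅ i ⁆)

open Hypergraph public

infix 4 _∈ᴴ_

_∈ᴴ_ : ∀ {n} → Subset n → Hypergraph n → Set
H ∈ᴴ ℋ = T (member ℋ H)

-- Membership is irrelevant, so hyperedges with the same underlying set are equal.
record Hyperedge {n} (ℋ : Hypergraph n) : Set where
  constructor ⟨_,_⟩
  field
    set       : Subset n
    .isMember : set ∈ᴴ ℋ

open Hyperedge public

-- S = [i , j] for some i ≤ j; in particular the empty set is not an interval.
IsInterval : ∀ {n} → Subset n → Set
IsInterval {n} S = ∃₂ λ (i j : Fin n) → i ≤ j × (∀ x → x ∈ S ⇔ (i ≤ x × x ≤ j))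

IsIntervalHypergraph : ∀ {n} → Hypergraph n → Set
IsIntervalHypergraph ℋ = ∀ {H} → H ∈ᴴ ℋ → IsInterval H

IsMin IsMax : ∀ {n} → Subset n → Fin n → Set
IsMin S x = x ∈ S × (∀ {y} → y ∈ S → x ≤ y)
IsMax S x = x ∈ S × (∀ {y} → y ∈ S → y ≤ x)

SameMin SameMax : ∀ {n} → Subset n → Subset n → Set
SameMin S K = ∃[ x ] (IsMin S x × IsMin K x)
SameMax S K = ∃[ x ] (IsMax S x × IsMax K x)

IsInitialOrFinalIn : ∀ {n} → Subset n → Subset n → Set
IsInitialOrFinalIn S K = SameMin S K ⊎ SameMax S K

IntersectionCondition : ∀ {n} → Hypergraph n → Set
IntersectionCondition ℐ =
  ∀ {I J} → I ∈ᴴ ℐ → J ∈ᴴ ℐ → I ⊈ J → I ⊉ J → Nonempty (I ∩ J) →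
  (I ∩ J) ∈ᴴ ℐ × (∀ {K} → K ∈ᴴ ℐ → I ∩ J ⊆ K → IsInitialOrFinalIn (I ∩ J) K)

module _ {n} (ℋ : Hypergraph n) where

  record Orientation : Set where
    field
      orient   : Hyperedge ℋ → Fin n
      orient-∈ : ∀ H → orient H ∈ set H

  open Orientation public

  -- H₁, …, H_k with k = m + 2 are H zero, …, H (fromℕ (suc m));
  -- p - x is p ∖ {x}.
  IsCycle : Orientation → ∀ {m} → (Fin (2 +ℕ m) → Hyperedge ℋ) → Set
  IsCycle O {m} H =
    (∀ (i : Fin (1 +ℕ m)) →
       orient O (H (suc i)) ∈ set (H (inject₁ i)) - orient O (H (inject₁ i))) ×
    orient O (H zero) ∈ set (H (fromℕ (1 +ℕ m))) - orient O (H (fromℕ (1 +ℕ m)))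

  Acyclic : Orientation → Set
  Acyclic O = ¬ (∃₂ λ m (H : Fin (2 +ℕ m) → Hyperedge ℋ) → IsCycle O H)

  record AcyclicOrientation : Set where
    field
      orientation : Orientation
      acyclic     : Acyclic orientation

    open Orientation orientation public
      renaming (orient to target; orient-∈ to target-∈)

  open AcyclicOrientation public

  infix 4 _≈_ _≤ᴾ_

  -- Equality of maps is pointwise.
  _≈_ : Rel AcyclicOrientation 0ℓ
  O ≈ O′ = ∀ H → target O H ≡ target O′ H

  IncreasingFlip : Rel AcyclicOrientation 0ℓ
  IncreasingFlip O O′ =
    ¬ (O ≈ O′) ×
    ∃₂ λ i j → i < j × (∀ H →
      (target O H ≢ target O′ H → target O H ≡ i × target O′ H ≡ j) ×
      (i ∈ set H × j ∈ set H → (target O H ≡ i ⇔ target O′ H ≡ j)))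

  -- The order of the hypergraphic poset: the transitive closure of increasing
  -- flips, made reflexive with respect to _≈_.
  _≤ᴾ_ : Rel AcyclicOrientation 0ℓ
  _≤ᴾ_ = StrictToNonStrict._≤_ _≈_ (TransClosure IncreasingFlip)

  HypergraphicPosetIsDistributiveLattice : Set
  HypergraphicPosetIsDistributiveLattice =
    ∃₂ λ _∨_ _∧_ → IsDistributiveLattice _≈_ _≤ᴾ_ _∨_ _∧_

{-# OPTIONS --safe #-}
module Submission where

-- For interval hypergraphs a directed cycle contains a directed 2-cycle, and the order
-- of the poset is the pointwise order of orientations.
--
-- If crossing edges I = [a , d] and J = [c , b] have [c , d] ∉ ℐ, then (for I ∪ J shortest)
-- four orientations O₁, O₂ ≤ U₁, U₂ have nothing in between, so there is no join O₁ ∨ O₂.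
-- If [c , d] lies strictly inside an edge K, then I ∩ K and J ∩ K yield a pentagon.
--
-- Conversely, under the condition the proper subedges of each edge J are laminar, so that
-- contracting the maximal ones turns J into a chain.  The class of O(J) in that chain may be
-- chosen independently for every J and these classes determine O, hence the poset is a
-- product of chains.

open import Data.Empty using (⊥; ⊥-elim)
open import Data.Fin.Base using (Fin; zero; suc; toℕ; inject₁; fromℕ; combine; _≤_; _<_)
open import Data.Fin.Properties
  using (_≟_; <-cmp; ≤-totalOrder; toℕ-injective; toℕ<n; toℕ-combine; combine-monoˡ-<; combine-injective)
open import Data.Fin.Subset
  using (Subset; Nonempty; _∈_; _∉_; _⊆_; _⊈_; _⊉_; _⊂_; _∩_; _-_; ⁅_⁆; ∣_∣)
open import Data.Fin.Subset.Properties
  using ( _∈?_; _⊆?_; _⊂?_; anySubset?; p─q⊆p; p─q─q≡p─q; x∈p⇒∣p-x∣<∣p∣; x∈p∧x≢y⇒x∈p-y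
        ; x∈⁅y⁆⇒x≡y; x∈p∩q⁺; x∈p∩q⁻; p∩q⊆p; p∩q⊆q; ∩-comm; ⊆-antisym; p⊂q⇒∣p∣<∣q∣)
open import Data.List.Base using (List; []; _∷_)
open import Data.Nat.Base as ℕ using (ℕ; _≥_; _*_) renaming (zero to 0#; suc to 1+_; _+_ to _+ℕ_)
import Data.Nat.Properties as ℕ
open import Data.Product.Base using (∃; _×_; _,_; proj₁; proj₂)
open import Data.Sum.Base using (_⊎_; inj₁; inj₂)
open import Function.Base using (_∘_)
open import Function.Bundles using (_⇔_; mk⇔; Equivalence)
open import Relation.Binary.Construct.Closure.Transitive using (TransClosure; [_]; _∷_; _∷ʳ_)
open import Relation.Binary.Definitions using (tri<; tri≈; tri>)
open import Relation.Binary.Lattice.Structures using (IsDistributiveLattice)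
open import Relation.Binary.PropositionalEquality
  using (_≡_; _≢_; refl; sym; trans; cong; cong₂; subst; subst₂; module ≡-Reasoning)
open import Relation.Binary.Structures using (IsPartialOrder)
open import Relation.Nullary.Decidable
  using (Dec; yes; no; map′; _×-dec_; _⊎-dec_; ¬?; T?; recompute; decidable-stable)
open import Relation.Nullary.Negation using (¬_; contradiction)
open import Defs

-- Elementary facts on finite ordinals and subsets.

toℕ-antisym : ∀ {n} {x y : Fin n} → x ≤ y → y ≤ x → x ≡ y
toℕ-antisym x≤y y≤x = toℕ-injective (ℕ.≤-antisym x≤y y≤x)

x∉p-x : ∀ {n} (p : Subset n) x → x ∉ p - x
x∉p-x p x x∈ = ℕ.<-irrefl (cong ∣_∣ (p─q─q≡p─q p ⁅ x ⁆)) (x∈p⇒∣p-x∣<∣p∣ x∈)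

-- Closed walks in digraphs with convex out-neighbourhoods.

module _ {n} (R : Fin n → Fin n → Set)
         (irrefl : ∀ {u} → ¬ R u u)
         (asym   : ∀ {u v} → R u v → ¬ R v u)
         (fill↑  : ∀ {u v w} → R u v → u < w → w ≤ v → R u w)
         (fill↓  : ∀ {u v w} → R u v → v ≤ w → w < u → R u w) where

  private
    From : ℕ → Fin n → Fin n → Set
    From t u v = t ℕ.≤ toℕ u × t ℕ.≤ toℕ v × R u v

    -- A passage u → t → w through the leftmost vertex t can be replaced by u → w.
    bypass : ∀ {t u v} → t ℕ.< toℕ v → TransClosure (From t) u v →
             (t ℕ.< toℕ u × TransClosure (From (1+ t)) u v) ⊎
             (toℕ u ≡ t × ∃ λ w → t ℕ.< toℕ w × R u w ×
                (w ≡ v ⊎ TransClosure (From (1+ t)) w v))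
    bypass {u = u} t<v [ t≤u , _ , uRv ] with ℕ.m≤n⇒m<n∨m≡n t≤u
    ... | inj₁ t<u  = inj₁ (t<u , [ t<u , t<v , uRv ])
    ... | inj₂ t≡u  = inj₂ (sym t≡u , _ , t<v , uRv , inj₁ refl)
    bypass {u = u} t<v (_∷_ {y = x} (t≤u , t≤x , uRx) xv)
      with ℕ.m≤n⇒m<n∨m≡n t≤u | bypass t<v xv
    ... | inj₁ t<u | inj₁ (t<x , xv′) = inj₁ (t<u , (t<u , t<x , uRx) ∷ xv′)
    ... | inj₂ t≡u | inj₁ (t<x , xv′) = inj₂ (sym t≡u , x , t<x , uRx , inj₂ xv′)
    ... | inj₂ t≡u | inj₂ (x≡t , _) =
      contradiction (subst (R u) (toℕ-injective (trans x≡t t≡u)) uRx) irrefl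
    ... | inj₁ t<u | inj₂ (refl , w , x<w , xRw , wv) with <-cmp u w
    -- The arc t → w passes over u, so convexity yields t → u, which contradicts u → t.
    ...   | tri< u<w _ _ = contradiction (fill↑ xRw t<u (ℕ.<⇒≤ u<w)) (asym uRx)
    ...   | tri≈ _ refl _ = contradiction xRw (asym uRx)
    ...   | tri> _ _ w<u = inj₁ (t<u , extend wv)
      where
      uRw = fill↓ uRx (ℕ.<⇒≤ x<w) w<u
      extend : ∀ {v} → w ≡ v ⊎ TransClosure (From _) w v → TransClosure (From _) u v
      extend (inj₁ refl) = [ t<u , x<w , uRw ]
      extend (inj₂ wv′)  = (t<u , x<w , uRw) ∷ wv′

    shrink : ∀ {t u} → TransClosure (From t) u u → ∃ λ v → TransClosure (From (1+ t)) v v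
    shrink {u = u} [ _ , _ , uRu ] = contradiction uRu irrefl
    shrink {u = u} uu@(_∷_ {y = x} (t≤u , t≤x , uRx) xu)
      with ℕ.m≤n⇒m<n∨m≡n t≤u | ℕ.m≤n⇒m<n∨m≡n t≤x
    ... | inj₁ t<u | _ with bypass t<u uu
    ...   | inj₁ (_ , uu′)  = u , uu′
    ...   | inj₂ (u≡t , _) = contradiction (sym u≡t) (ℕ.<⇒≢ t<u)
    -- `bypass` needs a walk that ends to the right of t, so a closed walk based at t is rotated by
    -- one step.
    shrink {u = u} (_∷_ {y = x} uRx@(_ , _ , uR′x) xu) | inj₂ t≡u | inj₁ t<x with bypass t<x (xu ∷ʳ uRx)
    ...   | inj₁ (_ , xx′)  = x , xx′
    ...   | inj₂ (x≡t , _) = contradiction (sym x≡t) (ℕ.<⇒≢ t<x)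
    shrink {u = u} (_∷_ {y = x} (_ , _ , uRx) xu) | inj₂ t≡u | inj₂ t≡x =
      contradiction (subst (R u) (toℕ-injective (trans (sym t≡x) t≡u)) uRx) irrefl

    iterate : ∀ k t {u} → n ℕ.≤ t +ℕ k → ¬ TransClosure (From t) u u
    iterate 0# t {u} n≤t+0 uu = ℕ.<-irrefl refl (ℕ.<-≤-trans (toℕ<n u)
      (ℕ.≤-trans (subst (n ℕ.≤_) (ℕ.+-identityʳ t) n≤t+0) (start uu)))
      where
      start : ∀ {u v} → TransClosure (From t) u v → t ℕ.≤ toℕ u
      start [ t≤u , _ ]     = t≤u
      start ((t≤u , _) ∷ _) = t≤u
    iterate (1+ k) t n≤ uu =
      iterate k (1+ t) (subst (n ℕ.≤_) (ℕ.+-suc t k) n≤) (proj₂ (shrink uu))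

  -- The leftmost admissible vertex is removed from the walk again and again; after n rounds no
  -- vertex is left.
  no-closed-walk : ∀ {u} → ¬ TransClosure R u u
  no-closed-walk = iterate n 0# ℕ.≤-refl ∘ lift
    where
    lift : ∀ {u v} → TransClosure R u v → TransClosure (From 0#) u v
    lift [ r ]    = [ ℕ.z≤n , ℕ.z≤n , r ]
    lift (r ∷ rs) = (ℕ.z≤n , ℕ.z≤n , r) ∷ lift rs

chain⁺ : ∀ {A : Set} {R : A → A → Set} m (f : Fin (2 +ℕ m) → A) →
         (∀ i → R (f (inject₁ i)) (f (suc i))) → TransClosure R (f zero) (f (fromℕ (1+ m)))
chain⁺ 0# f step     = [ step zero ]
chain⁺ (1+ m) f step = step zero ∷ chain⁺ m (f ∘ suc) (step ∘ suc)

combine-lex : ∀ {m n} {i i′ : Fin m} {j j′ : Fin n} → combine i′ j′ ≤ combine i j →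
              i′ ≤ i × (i′ ≡ i → j′ ≤ j)
combine-lex {n = n} {i} {i′} {j} {j′} c≤ =
  ℕ.≮⇒≥ (λ i<i′ → ℕ.<-irrefl refl (ℕ.<-≤-trans (combine-monoˡ-< j j′ i<i′) c≤)) ,
  λ { refl → ℕ.+-cancelˡ-≤ (n * toℕ i) _ _ (subst₂ ℕ._≤_ (toℕ-combine i j′) (toℕ-combine i j) c≤) }

least : ∀ {n} {P : Fin n → Set} → (∀ x → Dec (P x)) → ∃ P → ∃ λ x → P x × (∀ y → P y → x ≤ y)
least {1+ n} P? ∃P with P? zero | ∃P
... | yes p | _            = zero , p , λ _ _ → ℕ.z≤n
... | no ¬p | zero , p     = contradiction p ¬p
... | no ¬p | suc x , p with least (P? ∘ suc) (x , p)
...   | y , q , y≤ = suc y , q , λ { zero p → contradiction p ¬p ; (suc z) r → ℕ.s≤s (y≤ z r) }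

-- Edges as intervals.

module Intervals {n} (ℐ : Hypergraph n) (intervals : IsIntervalHypergraph ℐ) where

  Edge : Set
  Edge = Hyperedge ℐ

  AO : Set
  AO = AcyclicOrientation ℐ

  -- The membership field is irrelevant, but it is decidable and can be recomputed; the endpoints of
  -- an edge are extracted from it.
  isMember-relevant : (H : Edge) → set H ∈ᴴ ℐ
  isMember-relevant ⟨ S , m ⟩ = recompute (T? (member ℐ S)) m

  lo hi : Edge → Fin n
  lo H = proj₁ (intervals (isMember-relevant H))
  hi H = proj₁ (proj₂ (intervals (isMember-relevant H)))

  lo≤hi : ∀ H → lo H ≤ hi H
  lo≤hi H = proj₁ (proj₂ (proj₂ (intervals (isMember-relevant H))))

  ∈⁻ : ∀ H {x} → x ∈ set H → lo H ≤ x × x ≤ hi H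
  ∈⁻ H = Equivalence.to (proj₂ (proj₂ (proj₂ (intervals (isMember-relevant H)))) _)

  ∈⁺ : ∀ H {x} → lo H ≤ x → x ≤ hi H → x ∈ set H
  ∈⁺ H lo≤x x≤hi = Equivalence.from (proj₂ (proj₂ (proj₂ (intervals (isMember-relevant H)))) _) (lo≤x , x≤hi)

  lo∈ : ∀ H → lo H ∈ set H
  lo∈ H = ∈⁺ H ℕ.≤-refl (lo≤hi H)

  hi∈ : ∀ H → hi H ∈ set H
  hi∈ H = ∈⁺ H (lo≤hi H) ℕ.≤-refl

  convex : ∀ H {x y z} → x ∈ set H → z ∈ set H → x ≤ y → y ≤ z → y ∈ set H
  convex H x∈H z∈H x≤y y≤z =
    ∈⁺ H (ℕ.≤-trans (proj₁ (∈⁻ H x∈H)) x≤y) (ℕ.≤-trans y≤z (proj₂ (∈⁻ H z∈H)))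

  anyEdge? : ∀ {P : Edge → Set} → (∀ H → Dec (P H)) → Dec (∃ P)
  anyEdge? {P} P? = map′ (λ (S , m , p) → ⟨ S , m ⟩ , p)
                         (λ (H , p) → set H , isMember-relevant H , p)
                         (anySubset? λ S → dec S)
    where
    dec : ∀ S → Dec (∃ λ (m : S ∈ᴴ ℐ) → P ⟨ S , m ⟩)
    dec S with T? (member ℐ S)
    ... | no ∉ℐ = no (∉ℐ ∘ proj₁)
    ... | yes m = map′ (m ,_) proj₂ (P? ⟨ S , m ⟩)

  -- Acyclicity as absence of directed 2-cycles.

  Consistent : (Edge → Fin n) → Set
  Consistent f = ∀ H K → f H ∈ set K → f K ∈ set H → f H ≡ f K

  consistent : (O : AO) → Consistent (target O)
  consistent O H K OH∈K OK∈H = decidable-stable (target O H ≟ target O K) λ OH≢OK →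
    acyclic O (0 , (λ { zero → H ; (suc _) → K }) ,
      (λ { zero → x∈p∧x≢y⇒x∈p-y OK∈H (OH≢OK ∘ sym) }) , x∈p∧x≢y⇒x∈p-y OH∈K OH≢OK)

  module _ (f : Edge → Fin n) (f∈ : ∀ H → f H ∈ set H) (cons : Consistent f) where

    private
      O : Orientation ℐ
      O = record { orient = f ; orient-∈ = f∈ }

      -- A cycle H₁, ..., H_k of edges becomes the closed walk f(H₁) → ... → f(H_k) → f(H₁) in this
      -- digraph. Convexity of the edges gives the two filling properties, and consistency gives
      -- asymmetry.
      Arc : Fin n → Fin n → Set
      Arc u v = ∃ λ H → f H ≡ u × v ∈ set H × v ≢ u

      arc : ∀ H {v} → v ∈ set H - f H → Arc (f H) v
      arc H v∈ = H , refl , p─q⊆p (set H) ⁅ f H ⁆ v∈ , λ { refl → x∉p-x (set H) (f H) v∈ }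

      no-cycle : ∀ {u} → ¬ TransClosure Arc u u
      no-cycle = no-closed-walk Arc
        (λ (_ , _ , _ , u≢u) → u≢u refl)
        (λ { (H , refl , v∈H , v≢u) (K , refl , u∈K , u≢v) → u≢v (cons H K u∈K v∈H) })
        (λ { (H , refl , v∈H , _) u<w w≤v →
             H , refl , convex H (f∈ H) v∈H (ℕ.<⇒≤ u<w) w≤v , λ { refl → ℕ.<-irrefl refl u<w } })
        (λ { (H , refl , v∈H , _) v≤w w<u →
             H , refl , convex H v∈H (f∈ H) v≤w (ℕ.<⇒≤ w<u) , λ { refl → ℕ.<-irrefl refl w<u } })

    fromConsistent : AO
    fromConsistent = record
      { orientation = O
      ; acyclic     = λ (m , H , steps , last) →
          no-cycle (chain⁺ {R = Arc} m (f ∘ H) (λ i → arc (H (inject₁ i)) (steps i)) ∷ʳ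
                    arc (H (fromℕ (1+ m))) last)
      }

  -- The poset order is the pointwise order.

  infix 4 _⊑_

  _⊑_ : AO → AO → Set
  O ⊑ O′ = ∀ H → target O H ≤ target O′ H

  flip⇒⊑ : ∀ {O O′} → IncreasingFlip ℐ O O′ → O ⊑ O′
  flip⇒⊑ {O} {O′} (_ , i , j , i<j , flips) H with target O H ≟ target O′ H
  ... | yes eq = ℕ.≤-reflexive (cong toℕ eq)
  ... | no neq with proj₁ (flips H) neq
  ...   | refl , refl = ℕ.<⇒≤ i<j

  ≤ᴾ⇒⊑ : ∀ {O O′} → _≤ᴾ_ ℐ O O′ → O ⊑ O′
  ≤ᴾ⇒⊑ (inj₂ O≈O′) H     = ℕ.≤-reflexive (cong toℕ (O≈O′ H))
  ≤ᴾ⇒⊑ {O} (inj₁ flips) = go flips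
    where
    go : ∀ {O O′} → TransClosure (IncreasingFlip ℐ) O O′ → O ⊑ O′
    go {O} {O′} [ f ] = flip⇒⊑ {O} {O′} f
    go {O} (_∷_ {y = O″} f fs) H = ℕ.≤-trans (flip⇒⊑ {O} {O″} f H) (go fs H)

  ⊑-antisym : ∀ {O O′} → O ⊑ O′ → O′ ⊑ O → _≈_ ℐ O O′
  ⊑-antisym O⊑O′ O′⊑O H = toℕ-antisym (O⊑O′ H) (O′⊑O H)

  flip-respʳ-≈ : ∀ {O O′ O″} → IncreasingFlip ℐ O O′ → _≈_ ℐ O′ O″ → IncreasingFlip ℐ O O″
  flip-respʳ-≈ {O} {O′} {O″} (O≉O′ , i , j , i<j , flips) eq =
    (λ O≈O″ → O≉O′ (λ H → trans (O≈O″ H) (sym (eq H)))) , i , j , i<j ,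
    λ H → subst (λ v → (target O H ≢ v → target O H ≡ i × v ≡ j) ×
                       (i ∈ set H × j ∈ set H → (target O H ≡ i ⇔ v ≡ j)))
                (eq H) (flips H)

  flip-≤ᴾ : ∀ {O O′ O″} → IncreasingFlip ℐ O O′ → _≤ᴾ_ ℐ O′ O″ → _≤ᴾ_ ℐ O O″
  flip-≤ᴾ f (inj₁ fs)                   = inj₁ (f ∷ fs)
  flip-≤ᴾ {O} {O′} {O″} f (inj₂ O′≈O″) = inj₁ [ flip-respʳ-≈ {O} {O′} {O″} f O′≈O″ ]

  -- If O ⊑ O′ and (i , j) is the lexicographically largest pair (O H , O′ H) with
  -- O H ≢ O′ H, then the flip i → j of O is acyclic and stays below O′.
  module _ (O O′ : AO) (O⊑O′ : O ⊑ O′) (H₀ : Edge) (OH₀≢O′H₀ : target O H₀ ≢ target O′ H₀)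
           (lexmax : ∀ H → target O H ≢ target O′ H →
                     combine (target O H) (target O′ H) ≤ combine (target O H₀) (target O′ H₀))
    where

    private
      i j : Fin n
      i = target O H₀
      j = target O′ H₀

      i<j : i < j
      i<j = ℕ.≤∧≢⇒< (O⊑O′ H₀) (OH₀≢O′H₀ ∘ toℕ-injective)

      Flipped : Edge → Set
      Flipped H = target O H ≡ i × j ∈ set H

      flipped? : ∀ H → Dec (Flipped H)
      flipped? H = (target O H ≟ i) ×-dec (j ∈? set H)

      f : Edge → Fin n
      f H with flipped? H
      ... | yes _ = j
      ... | no _  = target O H

      f-flipped : ∀ {H} → Flipped H → f H ≡ j
      f-flipped {H} fl with flipped? H
      ... | yes _  = refl
      ... | no ¬fl = contradiction fl ¬fl

      i∈H₀ : i ∈ set H₀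
      i∈H₀ = target-∈ O H₀

      -- Otherwise the pair of K would be lexicographically larger than (i , j).
      fixed : ∀ {K} → i < target O K → target O′ K ≡ target O K
      fixed {K} i<OK = sym (decidable-stable (_ ≟ _) λ OK≢O′K →
        ℕ.<-irrefl refl (ℕ.<-≤-trans i<OK (proj₁ (combine-lex (lexmax K OK≢O′K)))))

      -- A value O′(H) > j would beat the maximal pair. A value O′(H) < j lies in H₀ because i and j
      -- do, and O′(H₀) = j lies in H, so consistency of O′ applies.
      flipped-target : ∀ {H} → Flipped H → target O′ H ≡ j
      flipped-target {H} (OH≡i , j∈H) with <-cmp (target O′ H) j
      ... | tri≈ _ eq _ = eq
      ... | tri> _ _ j<O′H = contradiction
        (proj₂ (combine-lex (lexmax H λ OH≡O′H →
           ℕ.<-irrefl (cong toℕ (trans (sym OH≡i) OH≡O′H)) (ℕ.<-trans i<j j<O′H))) OH≡i)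
        (ℕ.<⇒≱ j<O′H)
      ... | tri< O′H<j _ _ = consistent O′ H H₀
        (convex H₀ i∈H₀ (target-∈ O′ H₀) (subst (_≤ target O′ H) OH≡i (O⊑O′ H)) (ℕ.<⇒≤ O′H<j)) j∈H

      -- There is no directed path i → k → j, so reversing the arc i → j creates no cycle.
      no-detour : ∀ {H K} → Flipped H → target O K ∈ set H → j ∈ set K → ¬ (target O K ≢ i × target O K ≢ j)
      no-detour {H} {K} fl@(OH≡i , j∈H) OK∈H j∈K (k≢i , k≢j) with <-cmp (target O K) i
      ... | tri≈ _ k≡i _ = k≢i k≡i
      -- To the left of i the consistency of O gives k = i; to the right of i the edge K is fixed,
      -- and the consistency of O′ gives k = j.
      ... | tri< k<i _ _ = k≢i (trans (sym (consistent O H K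
              (subst (_∈ set K) (sym OH≡i) (convex K (target-∈ O K) j∈K (ℕ.<⇒≤ k<i) (ℕ.<⇒≤ i<j))) OK∈H)) OH≡i)
      ... | tri> _ _ i<k = k≢j (trans (sym (fixed {K} i<k)) (trans (sym (consistent O′ H K
              (subst (_∈ set K) (sym (flipped-target fl)) j∈K)
              (subst (_∈ set H) (sym (fixed {K} i<k)) OK∈H))) (flipped-target fl)))

      f∈ : ∀ H → f H ∈ set H
      f∈ H with flipped? H
      ... | yes (_ , j∈H) = j∈H
      ... | no _          = target-∈ O H

      mixed : ∀ {H K} → Flipped H → ¬ Flipped K → j ∈ set K → target O K ∈ set H → j ≡ target O K
      mixed {H} {K} fl ¬fl j∈K OK∈H = decidable-stable (_ ≟ _) λ j≢OK →
        no-detour fl OK∈H j∈K ((λ OK≡i → ¬fl (OK≡i , j∈K)) , j≢OK ∘ sym)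

      f-consistent : Consistent f
      f-consistent H K fH∈K fK∈H with flipped? H | flipped? K
      ... | yes _  | yes _  = refl
      ... | yes fl | no ¬fl = mixed fl ¬fl fH∈K fK∈H
      ... | no ¬fl | yes fl = sym (mixed fl ¬fl fK∈H fH∈K)
      ... | no _   | no _   = consistent O H K fH∈K fK∈H

    flipped : AO
    flipped = fromConsistent f f∈ f-consistent

    flipped-⊑ : flipped ⊑ O′
    flipped-⊑ H with flipped? H
    ... | yes fl = ℕ.≤-reflexive (cong toℕ (sym (flipped-target fl)))
    ... | no _   = O⊑O′ H

    flipped-isFlip : IncreasingFlip ℐ O flipped
    flipped-isFlip =
      (λ O≈fl → ℕ.<-irrefl (cong toℕ (trans (O≈fl H₀) (f-flipped (refl , target-∈ O′ H₀)))) i<j) ,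
      i , j , i<j , λ H → changed H , λ (i∈H , j∈H) →
        mk⇔ (λ OH≡i → f-flipped (OH≡i , j∈H)) (unchanged H i∈H)
      where
      changed : ∀ H → target O H ≢ f H → target O H ≡ i × f H ≡ j
      changed H neq with flipped? H
      ... | yes (OH≡i , _) = OH≡i , refl
      ... | no _           = contradiction refl neq
      unchanged : ∀ H → i ∈ set H → f H ≡ j → target O H ≡ i
      unchanged H i∈H fH≡j with flipped? H
      ... | yes (OH≡i , _) = OH≡i
      -- Here O(H) = j lies in H₀ and O(H₀) = i lies in H, so consistency of O equates them.
      ... | no _           = consistent O H H₀ (subst (_∈ set H₀) (sym fH≡j) (target-∈ O′ H₀)) i∈H

    -- An edge with pair (i , j) contains j, so it has been flipped and now agrees with O′. This
    -- strict decrease drives the recursion in `⊑⇒≤ᴾ`.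
    flipped-lex< : ∀ H → target flipped H ≢ target O′ H →
                   combine (target flipped H) (target O′ H) < combine i j
    flipped-lex< H neq with flipped? H
    ... | yes fl = contradiction (sym (flipped-target fl)) neq
    ... | no ¬fl = ℕ.≤∧≢⇒< (lexmax H neq) λ eq →
      let OH≡i , O′H≡j = combine-injective _ _ _ _ (toℕ-injective eq)
      in ¬fl (OH≡i , subst (_∈ set H) O′H≡j (target-∈ O′ H))

  -- Induction on a strict bound for the codes of the pairs at which O and O′ differ: if the largest
  -- allowed code occurs, that pair is flipped, and in either case the bound drops by one.
  ⊑⇒≤ᴾ : ∀ {O O′} → O ⊑ O′ → _≤ᴾ_ ℐ O O′
  ⊑⇒≤ᴾ {O} {O′} O⊑O′ = go (n * n) O O⊑O′ (λ H _ → toℕ<n (combine (target O H) (target O′ H)))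
    where
    go : ∀ N O → O ⊑ O′ →
         (∀ H → target O H ≢ target O′ H → toℕ (combine (target O H) (target O′ H)) ℕ.< N) →
         _≤ᴾ_ ℐ O O′
    go 0# O O⊑O′ bound = inj₂ λ H → decidable-stable (_ ≟ _) λ neq → contradiction (bound H neq) ℕ.n≮0
    go (1+ N) O O⊑O′ bound
      with anyEdge? (λ H → ¬? (target O H ≟ target O′ H) ×-dec
                           (toℕ (combine (target O H) (target O′ H)) ℕ.≟ N))
    ... | no none = go N O O⊑O′ λ H neq →
            ℕ.≤∧≢⇒< (ℕ.s≤s⁻¹ (bound H neq)) (λ eq → none (H , neq , eq))
    ... | yes (H₀ , neq₀ , refl) =
            flip-≤ᴾ {O} {flipped O O′ O⊑O′ H₀ neq₀ lexmax} {O′} (flipped-isFlip O O′ O⊑O′ H₀ neq₀ lexmax)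
              (go N (flipped O O′ O⊑O′ H₀ neq₀ lexmax) (flipped-⊑ O O′ O⊑O′ H₀ neq₀ lexmax)
                  (flipped-lex< O O′ O⊑O′ H₀ neq₀ lexmax))
      where
      lexmax : ∀ H → target O H ≢ target O′ H →
               combine (target O H) (target O′ H) ≤ combine (target O H₀) (target O′ H₀)
      lexmax H neq = ℕ.s≤s⁻¹ (bound H neq)

  -- Inclusion and crossing of edges in terms of endpoints.

  ⊆⁺ : ∀ I J → lo J ≤ lo I → hi I ≤ hi J → set I ⊆ set J
  ⊆⁺ I J lo≤ hi≤ x∈I = ∈⁺ J (ℕ.≤-trans lo≤ (proj₁ (∈⁻ I x∈I))) (ℕ.≤-trans (proj₂ (∈⁻ I x∈I)) hi≤)

  lo-mono : ∀ I J → set I ⊆ set J → lo J ≤ lo I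
  lo-mono I J I⊆J = proj₁ (∈⁻ J (I⊆J (lo∈ I)))

  hi-mono : ∀ I J → set I ⊆ set J → hi I ≤ hi J
  hi-mono I J I⊆J = proj₂ (∈⁻ J (I⊆J (hi∈ I)))

  Overlap : Edge → Edge → Set
  Overlap I J = lo I < lo J × lo J ≤ hi I × hi I < hi J

  crossing⇒overlap : ∀ I J → set I ⊈ set J → set I ⊉ set J → Nonempty (set I ∩ set J) →
                     Overlap I J ⊎ Overlap J I
  crossing⇒overlap I J I⊈J I⊉J (x , x∈I∩J) with x∈p∩q⁻ (set I) (set J) x∈I∩J | <-cmp (lo I) (lo J)
  ... | x∈I , x∈J | tri< lo< _ _ = inj₁
    (lo< , ℕ.≤-trans (proj₁ (∈⁻ J x∈J)) (proj₂ (∈⁻ I x∈I)) , ℕ.≰⇒> (I⊉J ∘ λ hi≤ → ⊆⁺ J I (ℕ.<⇒≤ lo<) hi≤))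
  ... | x∈I , x∈J | tri> _ _ lo> = inj₂
    (lo> , ℕ.≤-trans (proj₁ (∈⁻ I x∈I)) (proj₂ (∈⁻ J x∈J)) , ℕ.≰⇒> (I⊈J ∘ λ hi≤ → ⊆⁺ I J (ℕ.<⇒≤ lo>) hi≤))
  ... | _ | tri≈ _ lo≡ _ with ℕ.≤-total (toℕ (hi I)) (toℕ (hi J))
  ...   | inj₁ hi≤ = contradiction (λ {y} → ⊆⁺ I J (ℕ.≤-reflexive (cong toℕ (sym lo≡))) hi≤ {y}) I⊈J
  ...   | inj₂ hi≥ = contradiction (λ {y} → ⊆⁺ J I (ℕ.≤-reflexive (cong toℕ lo≡)) hi≥ {y}) I⊉J

  -- Acyclic orientations from priority lists.

  lo-consistent : Consistent lo
  lo-consistent H K lo∈K lo∈H = toℕ-antisym (proj₁ (∈⁻ H lo∈H)) (proj₁ (∈⁻ K lo∈K))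

  hi-consistent : Consistent hi
  hi-consistent H K hi∈K hi∈H = toℕ-antisym (proj₂ (∈⁻ K hi∈K)) (proj₂ (∈⁻ H hi∈H))

  -- With default `lo` or `hi` this is the orientation induced by the permutation that lists xs
  -- first and then the other points in increasing or decreasing order.
  greedy : List (Fin n) → (Edge → Fin n) → Edge → Fin n
  greedy []       d H = d H
  greedy (x ∷ xs) d H with x ∈? set H
  ... | yes _ = x
  ... | no _  = greedy xs d H

  greedy-hit : ∀ {x xs d} H → x ∈ set H → greedy (x ∷ xs) d H ≡ x
  greedy-hit {x} H x∈H with x ∈? set H
  ... | yes _  = refl
  ... | no x∉H = contradiction x∈H x∉H

  greedy-skip : ∀ {x xs d} H → x ∉ set H → greedy (x ∷ xs) d H ≡ greedy xs d H
  greedy-skip {x} H x∉H with x ∈? set H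
  ... | yes x∈H = contradiction x∈H x∉H
  ... | no _    = refl

  greedy-elim : ∀ {x xs d} (P : Fin n → Set) H →
                (x ∈ set H → P x) → (x ∉ set H → P (greedy xs d H)) → P (greedy (x ∷ xs) d H)
  greedy-elim {x} P H hit skip with x ∈? set H
  ... | yes x∈H = hit x∈H
  ... | no x∉H  = skip x∉H

  -- Reduces the comparison of two orientations in the pentagon below to the edges that contain both
  -- top priorities.
  greedy-swap : ∀ {x y xs d} H →
                (x ∈ set H × y ∈ set H) ⊎ greedy (y ∷ x ∷ xs) d H ≡ greedy (x ∷ y ∷ xs) d H
  greedy-swap {x} {y} {xs} {d} H = by (x ∈? set H) (y ∈? set H)
    where
    by : Dec (x ∈ set H) → Dec (y ∈ set H) →
         (x ∈ set H × y ∈ set H) ⊎ greedy (y ∷ x ∷ xs) d H ≡ greedy (x ∷ y ∷ xs) d H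
    by (yes x∈H) (yes y∈H) = inj₁ (x∈H , y∈H)
    by (yes x∈H) (no y∉H)  = inj₂ (trans (greedy-skip H y∉H) (trans (greedy-hit H x∈H) (sym (greedy-hit H x∈H))))
    by (no x∉H)  (yes y∈H) = inj₂ (trans (greedy-hit H y∈H) (sym (trans (greedy-skip H x∉H) (greedy-hit H y∈H))))
    by (no x∉H)  (no y∉H)  = inj₂ (trans (trans (greedy-skip H y∉H) (greedy-skip H x∉H))
                                         (sym (trans (greedy-skip H x∉H) (greedy-skip H y∉H))))

  module _ {d : Edge → Fin n} (d∈ : ∀ H → d H ∈ set H) (d-consistent : Consistent d) where

    greedy∈ : ∀ xs H → greedy xs d H ∈ set H
    greedy∈ []       H = d∈ H
    greedy∈ (x ∷ xs) H with x ∈? set H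
    ... | yes x∈H = x∈H
    ... | no _    = greedy∈ xs H

    greedy-consistent : ∀ xs → Consistent (greedy xs d)
    greedy-consistent []       H K = d-consistent H K
    greedy-consistent (x ∷ xs) H K gH∈K gK∈H with x ∈? set H | x ∈? set K
    ... | yes _  | yes _  = refl
    ... | yes _  | no x∉K = contradiction gH∈K x∉K
    ... | no x∉H | yes _  = contradiction gK∈H x∉H
    ... | no _   | no _   = greedy-consistent xs H K gH∈K gK∈H

    greedyAO : List (Fin n) → AO
    greedyAO xs = fromConsistent (greedy xs d) (greedy∈ xs) (greedy-consistent xs)

  lowest highest : List (Fin n) → AO
  lowest  = greedyAO lo∈ lo-consistent
  highest = greedyAO hi∈ hi-consistent

  -- Interpolation puts intersections of crossing edges into ℐ.

  HasEdge : Fin n → Fin n → Set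
  HasEdge x y = ∃ λ H → lo H ≡ x × hi H ≡ y

  singletonEdge : ∀ x → HasEdge x x
  singletonEdge x = S , x∈⁅y⁆⇒x≡y x (lo∈ S) , x∈⁅y⁆⇒x≡y x (hi∈ S)
    where
    S : Edge
    S = ⟨ ⁅ x ⁆ , singletons ℐ x ⟩

  -- The Riesz interpolation property; in a lattice O₁ ∨ O₂ is an interpolant.
  Interpolation : Set
  Interpolation = ∀ O₁ O₂ U₁ U₂ → O₁ ⊑ U₁ → O₁ ⊑ U₂ → O₂ ⊑ U₁ → O₂ ⊑ U₂ →
                  ∃ λ E → O₁ ⊑ E × O₂ ⊑ E × E ⊑ U₁ × E ⊑ U₂

  module _ (interpolate : Interpolation) where

    -- Here O₁, O₂ ⊑ U₁, U₂, but an orientation E with O₁, O₂ ⊑ E ⊑ U₁, U₂ would have E(I) = min J and E(J) = max I.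
    module _ (I J : Edge) (I∦J : Overlap I J) (lo≢hi : lo J ≢ hi I)
             (minimal : ∀ (H : Edge) → lo J ∈ set H → hi I ∈ set H → lo I ∉ set H → hi J ∉ set H → ⊥) where

      private
        a b c d : Fin n
        a = lo I
        b = hi J
        c = lo J
        d = hi I

        a<c : a < c
        a<c = proj₁ I∦J

        c≤d : c ≤ d
        c≤d = proj₁ (proj₂ I∦J)

        d<b : d < b
        d<b = proj₂ (proj₂ I∦J)

        -- O₂ and U₁ both send I to c, while O₁ and U₂ both send J to d; anything in between is
        -- therefore forced on I and J.
        O₁ O₂ U₁ U₂ : AO
        O₁ = lowest (a ∷ d ∷ [])
        O₂ = lowest (c ∷ [])
        U₁ = highest (b ∷ c ∷ [])
        U₂ = highest (d ∷ [])

        O₁⊑U₁ : O₁ ⊑ U₁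
        O₁⊑U₁ H = greedy-elim (_≤ target U₁ H) H
          (λ a∈H → greedy-elim (a ≤_) H (λ _ → ℕ.<⇒≤ (ℕ.<-trans (ℕ.<-≤-trans a<c c≤d) d<b)) λ _ →
                   greedy-elim (a ≤_) H (λ _ → ℕ.<⇒≤ a<c) λ _ → proj₂ (∈⁻ H a∈H))
          λ a∉H → greedy-elim (_≤ target U₁ H) H
            (λ d∈H → greedy-elim (d ≤_) H (λ _ → ℕ.<⇒≤ d<b) λ b∉H →
                     -- Here O₁(H) = d and U₁(H) = c, the one comparison that would fail; `minimal`
                     -- excludes such an edge.
                     greedy-elim (d ≤_) H (λ c∈H → ⊥-elim (minimal H c∈H d∈H a∉H b∉H)) λ _ →
                     proj₂ (∈⁻ H d∈H))
            λ _ → proj₁ (∈⁻ H (target-∈ U₁ H))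

        O₁⊑U₂ : O₁ ⊑ U₂
        O₁⊑U₂ H = greedy-elim (_≤ target U₂ H) H
          (λ a∈H → greedy-elim (a ≤_) H (λ _ → ℕ.<⇒≤ (ℕ.<-≤-trans a<c c≤d)) λ _ → proj₂ (∈⁻ H a∈H))
          λ _ → greedy-elim {d} (_≤ target U₂ H) H
            (λ d∈H → ℕ.≤-reflexive (cong toℕ (sym (greedy-hit {d} H d∈H))))
            λ _ → proj₁ (∈⁻ H (target-∈ U₂ H))

        O₂⊑U₁ : O₂ ⊑ U₁
        O₂⊑U₁ H = greedy-elim (_≤ target U₁ H) H
          (λ c∈H → greedy-elim (c ≤_) H (λ _ → ℕ.<⇒≤ (ℕ.≤-<-trans c≤d d<b)) λ _ →
                   greedy-elim (c ≤_) H (λ _ → ℕ.≤-refl) λ _ → proj₂ (∈⁻ H c∈H))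
          λ _ → proj₁ (∈⁻ H (target-∈ U₁ H))

        O₂⊑U₂ : O₂ ⊑ U₂
        O₂⊑U₂ H = greedy-elim (_≤ target U₂ H) H
          (λ c∈H → greedy-elim (c ≤_) H (λ _ → c≤d) λ _ → proj₂ (∈⁻ H c∈H))
          λ _ → proj₁ (∈⁻ H (target-∈ U₂ H))

        c∈I : c ∈ set I
        c∈I = ∈⁺ I (ℕ.<⇒≤ a<c) c≤d

        d∈J : d ∈ set J
        d∈J = ∈⁺ J c≤d (ℕ.<⇒≤ d<b)

        a∉J : a ∉ set J
        a∉J a∈J = ℕ.<⇒≱ a<c (proj₁ (∈⁻ J a∈J))

        b∉I : b ∉ set I
        b∉I b∈I = ℕ.<⇒≱ d<b (proj₂ (∈⁻ I b∈I))

      no-interpolant : ⊥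
      no-interpolant with interpolate O₁ O₂ U₁ U₂ O₁⊑U₁ O₁⊑U₂ O₂⊑U₁ O₂⊑U₂
      ... | E , O₁⊑E , O₂⊑E , E⊑U₁ , E⊑U₂ = lo≢hi (trans (sym EI≡c)
            (trans (consistent E I J (subst (_∈ set J) (sym EI≡c) (lo∈ J))
                                     (subst (_∈ set I) (sym EJ≡d) (hi∈ I))) EJ≡d))
        where
        EI≡c : target E I ≡ c
        EI≡c = toℕ-antisym
          (subst (target E I ≤_) (trans (greedy-skip I b∉I) (greedy-hit I c∈I)) (E⊑U₁ I))
          (subst (_≤ target E I) (greedy-hit I c∈I) (O₂⊑E I))
        EJ≡d : target E J ≡ d
        EJ≡d = toℕ-antisym
          (subst (target E J ≤_) (greedy-hit J d∈J) (E⊑U₂ J))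
          (subst (_≤ target E J) (trans (greedy-skip J a∉J) (greedy-hit J d∈J)) (O₁⊑E J))

    -- Induction on the length of I ∪ J: an edge H with I ∩ J ⊆ H and H strictly
    -- inside I ∪ J reduces the claim to shorter unions.
    overlap-closed : ∀ N {a b c d} → a < c → c ≤ d → d < b → toℕ b ℕ.≤ toℕ a +ℕ N →
                     HasEdge a d → HasEdge c b → HasEdge c d
    overlap-closed 0# {a} {b} a<c c≤d d<b b≤a _ _ = contradiction
      (ℕ.<-trans (ℕ.<-≤-trans a<c c≤d) d<b)
      (ℕ.≤⇒≯ (subst (toℕ b ℕ.≤_) (ℕ.+-identityʳ (toℕ a)) b≤a))
    overlap-closed (1+ N) {a} {b} {c} {d} a<c c≤d d<b b≤ ad@(I , refl , refl) cb@(J , refl , refl)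
      with anyEdge? (λ H → (lo H ≟ c) ×-dec (hi H ≟ d)) | c ≟ d
    ... | yes cd | _       = cd
    ... | no _   | yes c≡d = subst (HasEdge c) c≡d (singletonEdge c)
    ... | no ∄cd | no c≢d  = ⊥-elim (no-interpolant I J (a<c , c≤d , d<b) c≢d minimal)
      where
      b≤′ : toℕ b ℕ.≤ 1+ (toℕ a +ℕ N)
      b≤′ = subst (toℕ b ℕ.≤_) (ℕ.+-suc (toℕ a) N) b≤
      shorterʳ : ∀ {x} → a < x → toℕ b ℕ.≤ toℕ x +ℕ N
      shorterʳ a<x = ℕ.≤-trans b≤′ (ℕ.+-monoˡ-≤ N a<x)
      shorterˡ : ∀ {y} → y < b → toℕ y ℕ.≤ toℕ a +ℕ N
      shorterˡ y<b = ℕ.s≤s⁻¹ (ℕ.≤-trans y<b b≤′)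
      minimal : ∀ H → c ∈ set H → d ∈ set H → a ∉ set H → b ∉ set H → ⊥
      minimal H c∈H d∈H a∉H b∉H
        with ℕ.m≤n⇒m<n∨m≡n (proj₁ (∈⁻ H c∈H)) | ℕ.m≤n⇒m<n∨m≡n (proj₂ (∈⁻ H d∈H))
      ... | inj₂ x≡c | inj₂ d≡y = ∄cd (H , toℕ-injective x≡c , toℕ-injective (sym d≡y))
      ... | inj₁ x<c | inj₂ d≡y = ∄cd (overlap-closed N x<c c≤d d<b (shorterʳ a<x) (H , refl , toℕ-injective (sym d≡y)) cb)
        where
        a<x : a < lo H
        a<x = ℕ.≰⇒> λ x≤a → a∉H (convex H (lo∈ H) c∈H x≤a (ℕ.<⇒≤ a<c))
      ... | inj₂ x≡c | inj₁ d<y = ∄cd (overlap-closed N a<c c≤d d<y (shorterˡ y<b) ad (H , toℕ-injective x≡c , refl))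
        where
        y<b : hi H < b
        y<b = ℕ.≰⇒> λ b≤y → b∉H (convex H d∈H (hi∈ H) (ℕ.<⇒≤ d<b) b≤y)
      -- Write H = [x , y] with a < x < c and d < y < b. By induction [x , d] = I ∩ H and [c , y] =
      -- H ∩ J are edges, and their union [x , y] is shorter than [a , b], so induction applies to
      -- them as well.
      ... | inj₁ x<c | inj₁ d<y = ∄cd (overlap-closed N x<c c≤d d<y
                (ℕ.≤-trans (ℕ.<⇒≤ y<b) (shorterʳ a<x)) xd cy)
        where
        a<x : a < lo H
        a<x = ℕ.≰⇒> λ x≤a → a∉H (convex H (lo∈ H) c∈H x≤a (ℕ.<⇒≤ a<c))
        y<b : hi H < b
        y<b = ℕ.≰⇒> λ b≤y → b∉H (convex H d∈H (hi∈ H) (ℕ.<⇒≤ d<b) b≤y)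
        xd : HasEdge (lo H) d
        xd = overlap-closed N a<x (ℕ.<⇒≤ (ℕ.<-≤-trans x<c c≤d)) d<y (shorterˡ y<b) ad (H , refl , refl)
        cy : HasEdge c (hi H)
        cy = overlap-closed N x<c (ℕ.<⇒≤ (ℕ.≤-<-trans c≤d d<y)) y<b (shorterʳ a<x) (H , refl , refl) cb

    overlap⇒∩∈ᴴ : ∀ I J → Overlap I J → (set I ∩ set J) ∈ᴴ ℐ
    overlap⇒∩∈ᴴ I J (lo< , lo≤hi , hi<)
      with overlap-closed (toℕ (hi J)) lo< lo≤hi hi< (ℕ.m≤n+m _ _) (I , refl , refl) (J , refl , refl)
    ... | C , loC , hiC = subst (_∈ᴴ ℐ) (⊆-antisym C⊆I∩J I∩J⊆C) (isMember-relevant C)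
      where
      C⊆I∩J : set C ⊆ set I ∩ set J
      C⊆I∩J {x} x∈C = x∈p∩q⁺ (∈⁺ I (ℕ.≤-trans (ℕ.<⇒≤ lo<) lo≤x) x≤hi , ∈⁺ J lo≤x (ℕ.≤-trans x≤hi (ℕ.<⇒≤ hi<)))
        where
        lo≤x : lo J ≤ x
        lo≤x = subst (_≤ x) loC (proj₁ (∈⁻ C x∈C))
        x≤hi : x ≤ hi I
        x≤hi = subst (x ≤_) hiC (proj₂ (∈⁻ C x∈C))
      I∩J⊆C : set I ∩ set J ⊆ set C
      I∩J⊆C {x} x∈I∩J with x∈p∩q⁻ (set I) (set J) x∈I∩J
      ... | x∈I , x∈J =
        ∈⁺ C (subst (_≤ x) (sym loC) (proj₁ (∈⁻ J x∈J))) (subst (x ≤_) (sym hiC) (proj₂ (∈⁻ I x∈I)))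

    ∩∈ᴴ : ∀ I J → Nonempty (set I ∩ set J) → (set I ∩ set J) ∈ᴴ ℐ
    ∩∈ᴴ I J ne with set I ⊆? set J | set J ⊆? set I
    ... | yes I⊆J | _ = subst (_∈ᴴ ℐ)
      (⊆-antisym (λ x∈I → x∈p∩q⁺ (x∈I , I⊆J x∈I)) (p∩q⊆p (set I) (set J))) (isMember-relevant I)
    ... | no _ | yes J⊆I = subst (_∈ᴴ ℐ)
      (⊆-antisym (λ x∈J → x∈p∩q⁺ (J⊆I x∈J , x∈J)) (p∩q⊆q (set I) (set J))) (isMember-relevant J)
    ... | no I⊈J | no J⊈I with crossing⇒overlap I J I⊈J J⊈I ne
    ...   | inj₁ I∦J = overlap⇒∩∈ᴴ I J I∦J
    ...   | inj₂ J∦I = subst (_∈ᴴ ℐ) (∩-comm (set J) (set I)) (overlap⇒∩∈ᴴ J I J∦I)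

  -- Distributivity implies the intersection condition.

  module _ {_∨_ _∧_ : AO → AO → AO} (isDL : IsDistributiveLattice (_≈_ ℐ) (_≤ᴾ_ ℐ) _∨_ _∧_) where

    private module L = IsDistributiveLattice isDL

    interpolation : Interpolation
    interpolation O₁ O₂ U₁ U₂ O₁⊑U₁ O₁⊑U₂ O₂⊑U₁ O₂⊑U₂ =
      O₁ ∨ O₂ , ≤ᴾ⇒⊑ (L.x≤x∨y O₁ O₂) , ≤ᴾ⇒⊑ (L.y≤x∨y O₁ O₂) ,
      join-least U₁ O₁⊑U₁ O₂⊑U₁ , join-least U₂ O₁⊑U₂ O₂⊑U₂
      where
      join-least : ∀ U → O₁ ⊑ U → O₂ ⊑ U → (O₁ ∨ O₂) ⊑ U
      join-least U O₁⊑U O₂⊑U = ≤ᴾ⇒⊑ (L.∨-least (⊑⇒≤ᴾ {O₁} {U} O₁⊑U) (⊑⇒≤ᴾ {O₂} {U} O₂⊑U))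

    -- Z = Z ∧ (X ∨ Y) = (Z ∧ X) ∨ (Z ∧ Y), and both terms lie below Y. A pentagon violates this
    -- law.
    cancellation : ∀ {X Y Z} → Z ⊑ (X ∨ Y) → (Z ∧ X) ⊑ Y → Z ⊑ Y
    cancellation {X} {Y} {Z} Z⊑X∨Y Z∧X⊑Y = ≤ᴾ⇒⊑ (L.trans (L.∧-greatest L.refl (⊑⇒≤ᴾ {Z} {X ∨ Y} Z⊑X∨Y))
      (L.trans (L.reflexive (L.∧-distribˡ-∨ Z X Y)) (L.∨-least (⊑⇒≤ᴾ {Z ∧ X} {Y} Z∧X⊑Y) (L.x∧y≤y Z Y))))

    -- X, Y and Z generate a pentagon.
    no-edge-above-overlap : ∀ I J K → Overlap I J → set I ⊆ set K → set J ⊆ set K → ⊥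
    no-edge-above-overlap I J K (a<c , c≤d , d<b) I⊆K J⊆K = Z⋢Y (cancellation {X} {Y} {Z} Z⊑X∨Y Z∧X⊑Y)
      where
      a b c : Fin n
      a = lo I
      b = hi J
      c = lo J

      -- Y and Z differ only on edges containing both a and b: Y sends them to a, Z sends them to b,
      -- and X sends them to c.
      X Y Z : AO
      X = lowest (c ∷ [])
      Y = lowest (a ∷ b ∷ [])
      Z = lowest (b ∷ a ∷ [])

      a<b : a < b
      a<b = ℕ.<-trans (ℕ.<-≤-trans a<c c≤d) d<b

      X≡c : ∀ H → a ∈ set H → b ∈ set H → target X H ≡ c
      X≡c H a∈H b∈H = greedy-hit H (convex H a∈H b∈H (ℕ.<⇒≤ a<c) (lo≤hi J))

      a∉J : a ∉ set J
      a∉J a∈J = ℕ.<⇒≱ a<c (proj₁ (∈⁻ J a∈J))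

      b∉I : b ∉ set I
      b∉I b∈I = ℕ.<⇒≱ d<b (proj₂ (∈⁻ I b∈I))

      Z⊑X∨Y : Z ⊑ (X ∨ Y)
      Z⊑X∨Y H with greedy-swap {a} {b} H
      ... | inj₂ Z≡Y          = subst (_≤ target (X ∨ Y) H) (sym Z≡Y) (≤ᴾ⇒⊑ (L.y≤x∨y X Y) H)
      -- If E(H) < b, then c = X(H) ≤ E(H) puts E(H) into J, and J ⊆ H contains E(J); so E(H) = E(J)
      -- ≥ Y(J) = b.
      ... | inj₁ (a∈H , b∈H) = subst (_≤ target E H) (sym (greedy-hit H b∈H)) (ℕ.≮⇒≥ λ EH<b →
        let EH∈J = ∈⁺ J (subst (_≤ target E H) (X≡c H a∈H b∈H) (≤ᴾ⇒⊑ (L.x≤x∨y X Y) H)) (ℕ.<⇒≤ EH<b)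
            EJ∈H = convex H a∈H b∈H (ℕ.≤-trans (ℕ.<⇒≤ a<c) (proj₁ (∈⁻ J (target-∈ E J))))
                                    (proj₂ (∈⁻ J (target-∈ E J)))
            b≤EJ = subst (_≤ target E J) (trans (greedy-skip J a∉J) (greedy-hit J (hi∈ J)))
                         (≤ᴾ⇒⊑ (L.y≤x∨y X Y) J)
        in ℕ.<⇒≱ EH<b (subst (b ≤_) (sym (consistent E H J EH∈J EJ∈H)) b≤EJ))
        where
        E : AO
        E = X ∨ Y

      Z∧X⊑Y : (Z ∧ X) ⊑ Y
      Z∧X⊑Y H with greedy-swap {a} {b} H
      ... | inj₂ Z≡Y          = subst (target (Z ∧ X) H ≤_) Z≡Y (≤ᴾ⇒⊑ (L.x∧y≤x Z X) H)
      -- Dually, a < F(H) ≤ X(H) = c puts F(H) into I, and I ⊆ H contains F(I); so F(H) = F(I) ≤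
      -- Z(I) = a.
      ... | inj₁ (a∈H , b∈H) = subst (target F H ≤_) (sym (greedy-hit H a∈H)) (ℕ.≮⇒≥ λ a<FH →
        let FH≤c = subst (target F H ≤_) (X≡c H a∈H b∈H) (≤ᴾ⇒⊑ (L.x∧y≤y Z X) H)
            FH∈I = ∈⁺ I (ℕ.<⇒≤ a<FH) (ℕ.≤-trans FH≤c c≤d)
            FI∈H = convex H a∈H b∈H (proj₁ (∈⁻ I (target-∈ F I)))
                     (ℕ.≤-trans (proj₂ (∈⁻ I (target-∈ F I))) (ℕ.<⇒≤ d<b))
            FI≤a = subst (target F I ≤_) (trans (greedy-skip I b∉I) (greedy-hit I (lo∈ I)))
                         (≤ᴾ⇒⊑ (L.x∧y≤x Z X) I)
        in ℕ.<⇒≱ a<FH (subst (_≤ a) (sym (consistent F H I FH∈I FI∈H)) FI≤a))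
        where
        F : AO
        F = Z ∧ X

      Z⋢Y : ¬ (Z ⊑ Y)
      Z⋢Y Z⊑Y = ℕ.<⇒≱ a<b (subst₂ _≤_ (greedy-hit K (J⊆K (hi∈ J))) (greedy-hit K (I⊆K (lo∈ I))) (Z⊑Y K))

    -- If K extends beyond I ∩ J on both sides, then I ∩ K and J ∩ K are edges that overlap inside
    -- K, which `no-edge-above-overlap` forbids.
    overlap⇒initialOrFinal : ∀ I J K → Overlap I J → set I ∩ set J ⊆ set K →
                             IsInitialOrFinalIn (set I ∩ set J) (set K)
    overlap⇒initialOrFinal I J K (a<c , c≤d , d<b) I∩J⊆K with lo K ≟ lo J | hi K ≟ hi I
    ... | yes x≡c | _ = inj₁ (lo J , (x∈p∩q⁺ (∈⁺ I (ℕ.<⇒≤ a<c) c≤d , lo∈ J) ,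
            λ y∈ → proj₁ (∈⁻ J (proj₂ (x∈p∩q⁻ (set I) (set J) y∈)))) ,
            I∩J⊆K (x∈p∩q⁺ (∈⁺ I (ℕ.<⇒≤ a<c) c≤d , lo∈ J)) ,
            λ {y} y∈K → subst (_≤ y) x≡c (proj₁ (∈⁻ K y∈K)))
    ... | no _ | yes y≡d = inj₂ (hi I , (x∈p∩q⁺ (hi∈ I , ∈⁺ J c≤d (ℕ.<⇒≤ d<b)) ,
            λ y∈ → proj₂ (∈⁻ I (proj₁ (x∈p∩q⁻ (set I) (set J) y∈)))) ,
            I∩J⊆K (x∈p∩q⁺ (hi∈ I , ∈⁺ J c≤d (ℕ.<⇒≤ d<b))) ,
            λ {y} y∈K → subst (y ≤_) y≡d (proj₂ (∈⁻ K y∈K)))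
    ... | no x≢c | no y≢d = ⊥-elim (no-edge-above-overlap I∩K J∩K K
            (ℕ.<-≤-trans lo-I∩K<c (lo-mono J∩K J (p∩q⊆p (set J) (set K))) ,
             ℕ.≤-trans (proj₁ (∈⁻ J∩K (x∈p∩q⁺ (lo∈ J , c∈K)))) (proj₂ (∈⁻ I∩K (x∈p∩q⁺ (c∈I , c∈K)))) ,
             ℕ.≤-<-trans (hi-mono I∩K I (p∩q⊆p (set I) (set K))) d<hi-J∩K)
            (p∩q⊆q (set I) (set K)) (p∩q⊆q (set J) (set K)))
      where
      c∈I : lo J ∈ set I
      c∈I = ∈⁺ I (ℕ.<⇒≤ a<c) c≤d
      d∈J : hi I ∈ set J
      d∈J = ∈⁺ J c≤d (ℕ.<⇒≤ d<b)
      c∈K : lo J ∈ set K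
      c∈K = I∩J⊆K (x∈p∩q⁺ (c∈I , lo∈ J))
      d∈K : hi I ∈ set K
      d∈K = I∩J⊆K (x∈p∩q⁺ (hi∈ I , d∈J))
      x<c : lo K < lo J
      x<c = ℕ.≤∧≢⇒< (proj₁ (∈⁻ K c∈K)) (x≢c ∘ toℕ-injective)
      d<y : hi I < hi K
      d<y = ℕ.≤∧≢⇒< (proj₂ (∈⁻ K d∈K)) (y≢d ∘ sym ∘ toℕ-injective)
      I∩K J∩K : Edge
      I∩K = ⟨ set I ∩ set K , ∩∈ᴴ interpolation I K (lo J , x∈p∩q⁺ (c∈I , c∈K)) ⟩
      J∩K = ⟨ set J ∩ set K , ∩∈ᴴ interpolation J K (lo J , x∈p∩q⁺ (lo∈ J , c∈K)) ⟩
      lo-I∩K<c : lo I∩K < lo J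
      lo-I∩K<c with ℕ.≤-total (toℕ (lo I)) (toℕ (lo K))
      ... | inj₁ a≤x = ℕ.≤-<-trans (proj₁ (∈⁻ I∩K (x∈p∩q⁺ (convex I (lo∈ I) c∈I a≤x (ℕ.<⇒≤ x<c) , lo∈ K)))) x<c
      ... | inj₂ x≤a = ℕ.≤-<-trans (proj₁ (∈⁻ I∩K (x∈p∩q⁺ (lo∈ I , convex K (lo∈ K) c∈K x≤a (ℕ.<⇒≤ a<c))))) a<c
      d<hi-J∩K : hi I < hi J∩K
      d<hi-J∩K with ℕ.≤-total (toℕ (hi J)) (toℕ (hi K))
      ... | inj₁ b≤y = ℕ.<-≤-trans d<b (proj₂ (∈⁻ J∩K (x∈p∩q⁺ (hi∈ J , convex K d∈K (hi∈ K) (ℕ.<⇒≤ d<b) b≤y))))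
      ... | inj₂ y≤b = ℕ.<-≤-trans d<y (proj₂ (∈⁻ J∩K (x∈p∩q⁺ (convex J d∈J (hi∈ J) (ℕ.<⇒≤ d<y) y≤b , hi∈ K))))

    distributive⇒intersectionCondition : IntersectionCondition ℐ
    distributive⇒intersectionCondition {S} {T} S∈ T∈ S⊈T S⊉T ne
      with crossing⇒overlap ⟨ S , S∈ ⟩ ⟨ T , T∈ ⟩ S⊈T S⊉T ne
    ... | inj₁ I∦J = overlap⇒∩∈ᴴ interpolation ⟨ S , S∈ ⟩ ⟨ T , T∈ ⟩ I∦J ,
            λ K∈ I∩J⊆K → overlap⇒initialOrFinal ⟨ S , S∈ ⟩ ⟨ T , T∈ ⟩ ⟨ _ , K∈ ⟩ I∦J I∩J⊆K
    ... | inj₂ J∦I = subst (λ C → C ∈ᴴ ℐ × (∀ {K} → K ∈ᴴ ℐ → C ⊆ K → IsInitialOrFinalIn C K))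
            (∩-comm T S)
            (overlap⇒∩∈ᴴ interpolation ⟨ T , T∈ ⟩ ⟨ S , S∈ ⟩ J∦I ,
             λ K∈ J∩I⊆K → overlap⇒initialOrFinal ⟨ T , T∈ ⟩ ⟨ S , S∈ ⟩ ⟨ _ , K∈ ⟩ J∦I J∩I⊆K)

  -- Laminarity of subedges under the intersection condition.

  argmax : ∀ {P : Edge → Set} → (∀ H → Dec (P H)) → (f : Edge → ℕ) (N : ℕ) →
           (∀ H → P H → f H ℕ.≤ N) → ∃ P → ∃ λ H → P H × (∀ K → P K → f K ℕ.≤ f H)
  argmax P? f 0# bound (H , p) = H , p , λ K q → ℕ.≤-trans (bound K q) ℕ.z≤n
  argmax P? f (1+ N) bound ∃P with anyEdge? (λ H → P? H ×-dec (f H ℕ.≟ 1+ N))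
  ... | yes (H , p , fH≡) = H , p , λ K q → ℕ.≤-trans (bound K q) (ℕ.≤-reflexive (sym fH≡))
  ... | no none           =
    argmax P? f N (λ H p → ℕ.s≤s⁻¹ (ℕ.≤∧≢⇒< (bound H p) λ eq → none (H , p , eq))) ∃P

  edge-≡ : ∀ {I J : Edge} → set I ≡ set J → I ≡ J
  edge-≡ {⟨ _ , _ ⟩} {⟨ _ , _ ⟩} refl = refl

  ⊆⇒≡⊎⊂ : ∀ I J → set I ⊆ set J → I ≡ J ⊎ set I ⊂ set J
  ⊆⇒≡⊎⊂ I J I⊆J with lo J ∈? set I | hi J ∈? set I
  ... | no lo∉I  | _        = inj₂ (I⊆J , lo J , lo∈ J , lo∉I)
  ... | yes _    | no hi∉I  = inj₂ (I⊆J , hi J , hi∈ J , hi∉I)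
  ... | yes lo∈I | yes hi∈I =
    inj₁ (edge-≡ (⊆-antisym I⊆J (⊆⁺ J I (proj₁ (∈⁻ I lo∈I)) (proj₂ (∈⁻ I hi∈I)))))

  module _ (cond : IntersectionCondition ℐ) where

    -- If min K lies in I ∩ J, then min J ≤ min K ≤ min I, so I does not start before J; dually for
    -- max K.
    ¬overlap : ∀ (I J K : Edge) → set I ⊆ set K → set J ⊆ set K →
               IsInitialOrFinalIn (set I ∩ set J) (set K) → ¬ Overlap I J
    ¬overlap I J K I⊆K J⊆K (inj₁ (z , (z∈I∩J , _) , (_ , z≤))) (lo< , _) =
      ℕ.<⇒≱ lo< (ℕ.≤-trans (proj₁ (∈⁻ J (proj₂ (x∈p∩q⁻ (set I) (set J) z∈I∩J)))) (z≤ (I⊆K (lo∈ I))))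
    ¬overlap I J K I⊆K J⊆K (inj₂ (z , (z∈I∩J , _) , (_ , ≤z))) (_ , _ , hi<) =
      ℕ.<⇒≱ hi< (ℕ.≤-trans (≤z (J⊆K (hi∈ J))) (proj₂ (∈⁻ I (proj₁ (x∈p∩q⁻ (set I) (set J) z∈I∩J)))))

    laminar : ∀ (I J K : Edge) {x} → set I ⊆ set K → set J ⊆ set K → x ∈ set I → x ∈ set J →
              set I ⊆ set J ⊎ set J ⊆ set I
    laminar I J K {x} I⊆K J⊆K x∈I x∈J with set I ⊆? set J | set J ⊆? set I
    ... | yes I⊆J | _       = inj₁ I⊆J
    ... | no _    | yes J⊆I = inj₂ J⊆I
    ... | no I⊈J  | no J⊈I with crossing⇒overlap I J I⊈J J⊈I (x , x∈p∩q⁺ (x∈I , x∈J))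
    ...   | inj₁ I∦J = ⊥-elim (¬overlap I J K I⊆K J⊆K
            (proj₂ (cond (isMember-relevant I) (isMember-relevant J) I⊈J J⊈I (x , x∈p∩q⁺ (x∈I , x∈J)))
              (isMember-relevant K) (I⊆K ∘ p∩q⊆p (set I) (set J))) I∦J)
    ...   | inj₂ J∦I = ⊥-elim (¬overlap J I K J⊆K I⊆K
            (proj₂ (cond (isMember-relevant J) (isMember-relevant I) J⊈I I⊈J (x , x∈p∩q⁺ (x∈J , x∈I)))
              (isMember-relevant K) (J⊆K ∘ p∩q⊆p (set J) (set I))) J∦I)

    -- By laminarity, J modulo Linked is a chain of intervals: the maximal proper
    -- subedges of J and the remaining points.
    Linked : Edge → Fin n → Fin n → Set
    Linked J x y = x ≡ y ⊎ ∃ λ (I : Edge) → set I ⊂ set J × x ∈ set I × y ∈ set I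

    linked? : ∀ J x y → Dec (Linked J x y)
    linked? J x y = (x ≟ y) ⊎-dec anyEdge? λ (I : Edge) → (set I ⊂? set J) ×-dec (x ∈? set I) ×-dec (y ∈? set I)

    linked-sym : ∀ J {x y} → Linked J x y → Linked J y x
    linked-sym J (inj₁ x≡y)                   = inj₁ (sym x≡y)
    linked-sym J (inj₂ (I , I⊂J , x∈I , y∈I)) = inj₂ (I , I⊂J , y∈I , x∈I)

    linked-trans : ∀ J {x y z} → Linked J x y → Linked J y z → Linked J x z
    linked-trans J (inj₁ refl) yz = yz
    linked-trans J xy@(inj₂ _) (inj₁ refl) = xy
    linked-trans J (inj₂ (I , I⊂J , x∈I , y∈I)) (inj₂ (I′ , I′⊂J , y∈I′ , z∈I′))
      with laminar I I′ J (proj₁ I⊂J) (proj₁ I′⊂J) y∈I y∈I′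
    ... | inj₁ I⊆I′ = inj₂ (I′ , I′⊂J , I⊆I′ x∈I , z∈I′)
    ... | inj₂ I′⊆I = inj₂ (I , I⊂J , x∈I , I′⊆I z∈I′)

    private
      leastLinked : ∀ J x → ∃ λ y → Linked J x y × (∀ z → Linked J x z → y ≤ z)
      leastLinked J x = least (linked? J x) (x , inj₁ refl)

    rep : Edge → Fin n → Fin n
    rep J x = proj₁ (leastLinked J x)

    rep-linked : ∀ J x → Linked J x (rep J x)
    rep-linked J x = proj₁ (proj₂ (leastLinked J x))

    rep-least : ∀ J {x y} → Linked J x y → rep J x ≤ y
    rep-least J {x} = proj₂ (proj₂ (leastLinked J x)) _

    rep-cong : ∀ J {x y} → Linked J x y → rep J x ≡ rep J y
    rep-cong J {x} {y} xy = toℕ-antisym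
      (rep-least J (linked-trans J xy (rep-linked J y)))
      (rep-least J (linked-trans J (linked-sym J xy) (rep-linked J x)))

    rep-injective : ∀ J {x y} → rep J x ≡ rep J y → Linked J x y
    rep-injective J {x} {y} eq =
      linked-trans J (subst (Linked J x) eq (rep-linked J x)) (linked-sym J (rep-linked J y))

    -- Classes are convex: if rep y < rep x ≤ x ≤ y, the subedge linking y to rep y contains x,
    -- whence rep x ≤ rep y.
    rep-mono : ∀ J {x y} → x ≤ y → rep J x ≤ rep J y
    rep-mono J {x} {y} x≤y = ℕ.≮⇒≥ λ ry<rx → absurd ry<rx (rep-linked J y)
      where
      rx≤x : rep J x ≤ x
      rx≤x = rep-least J (inj₁ refl)
      absurd : rep J y < rep J x → Linked J y (rep J y) → ⊥
      absurd ry<rx (inj₁ y≡ry) =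
        ℕ.<⇒≱ ry<rx (ℕ.≤-trans rx≤x (subst (x ≤_) y≡ry x≤y))
      absurd ry<rx (inj₂ (I , I⊂J , y∈I , ry∈I)) = ℕ.<⇒≱ ry<rx
        (rep-least J (inj₂ (I , I⊂J , convex I ry∈I y∈I (ℕ.<⇒≤ (ℕ.<-≤-trans ry<rx rx≤x)) x≤y , ry∈I)))

    -- The least elements of the classes in J, which serve as the points of the chain at J.
    Admissible : Edge → Fin n → Set
    Admissible J x = x ∈ set J × rep J x ≡ x

    rep-admissible : ∀ J {x} → x ∈ set J → Admissible J (rep J x)
    rep-admissible J {x} x∈J = stays (rep-linked J x) , sym (rep-cong J (rep-linked J x))
      where
      stays : ∀ {y} → Linked J x y → y ∈ set J
      stays (inj₁ refl)                   = x∈J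
      stays (inj₂ (_ , I⊂J , _ , y∈I)) = proj₁ I⊂J y∈I

    -- Coordinates in a product of chains.

    coord : AO → Edge → Fin n
    coord O J = rep J (target O J)

    coord-mono : ∀ O O′ → O ⊑ O′ → ∀ J → coord O J ≤ coord O′ J
    coord-mono O O′ O⊑O′ J = rep-mono J (O⊑O′ J)

    -- Induction on the size of J. Targets in different classes are compared by their classes;
    -- targets in a common proper subedge I are, by consistency, the targets of I.
    coord-reflects : ∀ O O′ → (∀ J → coord O J ≤ coord O′ J) → O ⊑ O′
    coord-reflects O O′ cO≤cO′ J = go (1+ ∣ set J ∣) J ℕ.≤-refl
      where
      go : ∀ k J → ∣ set J ∣ ℕ.< k → target O J ≤ target O′ J
      go (1+ k) J ∣J∣<k with linked? J (target O J) (target O′ J)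
      ... | yes (inj₁ eq) = ℕ.≤-reflexive (cong toℕ eq)
      ... | yes (inj₂ (I , I⊂J , OJ∈I , O′J∈I)) = subst₂ _≤_
              (consistent O I J (proj₁ I⊂J (target-∈ O I)) OJ∈I)
              (consistent O′ I J (proj₁ I⊂J (target-∈ O′ I)) O′J∈I)
              (go k I (ℕ.<-≤-trans (p⊂q⇒∣p∣<∣q∣ I⊂J) (ℕ.s≤s⁻¹ ∣J∣<k)))
      ... | no ¬linked = ℕ.≮⇒≥ λ O′J<OJ →
              ¬linked (rep-injective J (toℕ-antisym (cO≤cO′ J) (rep-mono J (ℕ.<⇒≤ O′J<OJ))))

    -- Realising prescribed coordinates.

    module _ (c : Edge → Fin n) (c-admissible : ∀ J → Admissible J (c J)) where

      -- What consistency demands of x = O(J): a subedge I containing x also has target x, so x must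
      -- have the class prescribed at I.
      Realises : Edge → Fin n → Set
      Realises J x = x ∈ set J × (∀ I → set I ⊆ set J → x ∈ set I → rep I x ≡ c I)

      restrict : ∀ {I J : Edge} {x} → set I ⊆ set J → x ∈ set I → Realises J x → Realises I x
      restrict I⊆J x∈I (_ , good) = x∈I , λ K K⊆I → good K (I⊆J ∘ K⊆I)

      -- If the class of c(J) is a single point, that point is taken; otherwise the class is the
      -- largest proper subedge I containing c(J), and a realiser of I serves for J.
      realiser : ∀ J → ∃ (Realises J)
      realiser J = go (1+ ∣ set J ∣) J ℕ.≤-refl
        where
        go : ∀ k J → ∣ set J ∣ ℕ.< k → ∃ (Realises J)
        go (1+ k) J ∣J∣<k with anyEdge? (λ I → (set I ⊂? set J) ×-dec (c J ∈? set I))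
        ... | no none = c J , proj₁ (c-admissible J) , good
          where
          good : ∀ I → set I ⊆ set J → c J ∈ set I → rep I (c J) ≡ c I
          good I I⊆J cJ∈I with ⊆⇒≡⊎⊂ I J I⊆J
          ... | inj₁ refl = proj₂ (c-admissible J)
          ... | inj₂ I⊂J  = contradiction (I , I⊂J , cJ∈I) none
        ... | yes some
          with argmax (λ I → (set I ⊂? set J) ×-dec (c J ∈? set I)) (λ I → ∣ set I ∣) ∣ set J ∣
                      (λ I (I⊂J , _) → ℕ.<⇒≤ (p⊂q⇒∣p∣<∣q∣ I⊂J)) some
        ... | I , (I⊂J , cJ∈I) , largest
          with go k I (ℕ.<-≤-trans (p⊂q⇒∣p∣<∣q∣ I⊂J) (ℕ.s≤s⁻¹ ∣J∣<k))
        ... | x , x∈I , good = x , proj₁ I⊂J x∈I , good′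
          where
          -- For K = J, x is linked to c(J) through I. A proper subedge K containing x is comparable
          -- with I by laminarity, and I ⊆ K forces K = I by maximality.
          good′ : ∀ K → set K ⊆ set J → x ∈ set K → rep K x ≡ c K
          good′ K K⊆J x∈K with ⊆⇒≡⊎⊂ K J K⊆J
          ... | inj₁ refl = trans (rep-cong J (inj₂ (I , I⊂J , x∈I , cJ∈I))) (proj₂ (c-admissible J))
          ... | inj₂ K⊂J with laminar K I J K⊆J (proj₁ I⊂J) x∈K x∈I
          ...   | inj₁ K⊆I = good K K⊆I x∈K
          ...   | inj₂ I⊆K with ⊆⇒≡⊎⊂ I K I⊆K
          ...     | inj₁ refl = good I (λ y∈I → y∈I) x∈I
          ...     | inj₂ I⊂K  = contradiction (p⊂q⇒∣p∣<∣q∣ I⊂K) (ℕ.≤⇒≯ (largest K (K⊂J , I⊆K cJ∈I)))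

      -- Both points lie in the class prescribed at J. If they differ, a proper subedge contains
      -- both, and both realise it too.
      realiser-unique : ∀ J {x y} → Realises J x → Realises J y → x ≡ y
      realiser-unique J = go (1+ ∣ set J ∣) J ℕ.≤-refl
        where
        go : ∀ k J → ∣ set J ∣ ℕ.< k → ∀ {x y} → Realises J x → Realises J y → x ≡ y
        go (1+ k) J ∣J∣<k rx@(x∈J , goodx) ry@(y∈J , goody)
          with rep-injective J (trans (goodx J (λ z∈J → z∈J) x∈J) (sym (goody J (λ z∈J → z∈J) y∈J)))
        ... | inj₁ x≡y = x≡y
        ... | inj₂ (I , I⊂J , x∈I , y∈I) = go k I (ℕ.<-≤-trans (p⊂q⇒∣p∣<∣q∣ I⊂J) (ℕ.s≤s⁻¹ ∣J∣<k))
                (restrict {I} {J} (proj₁ I⊂J) x∈I rx) (restrict {I} {J} (proj₁ I⊂J) y∈I ry)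

      private
        f : Edge → Fin n
        f J = proj₁ (realiser J)

        f∈ : ∀ J → f J ∈ set J
        f∈ J = proj₁ (proj₂ (realiser J))

        common : ∀ (C I J : Edge) → set C ⊆ set I → set C ⊆ set J → f I ∈ set C → f J ∈ set C → f I ≡ f J
        common C I J C⊆I C⊆J fI∈C fJ∈C = realiser-unique C
          (restrict {C} {I} C⊆I fI∈C (proj₂ (realiser I))) (restrict {C} {J} C⊆J fJ∈C (proj₂ (realiser J)))

        f-consistent : Consistent f
        f-consistent I J fI∈J fJ∈I with set I ⊆? set J | set J ⊆? set I
        ... | yes I⊆J | _       = common I I J (λ x∈I → x∈I) I⊆J (f∈ I) fJ∈I
        ... | no _    | yes J⊆I = common J I J J⊆I (λ x∈J → x∈J) fI∈J (f∈ J)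
        ... | no I⊈J  | no J⊈I  =
          -- As I ∩ J is an edge, both values realise it and agree by uniqueness.
          common ⟨ set I ∩ set J , proj₁ (cond (isMember-relevant I) (isMember-relevant J) I⊈J J⊈I (f I , fI∈I∩J)) ⟩
                 I J (p∩q⊆p (set I) (set J)) (p∩q⊆q (set I) (set J)) fI∈I∩J (x∈p∩q⁺ (fJ∈I , f∈ J))
          where
          fI∈I∩J : f I ∈ set I ∩ set J
          fI∈I∩J = x∈p∩q⁺ (f∈ I , fI∈J)

      realise : AO
      realise = fromConsistent f f∈ f-consistent

      coord-realise : ∀ J → coord realise J ≡ c J
      coord-realise J = proj₂ (proj₂ (realiser J)) J (λ x∈J → x∈J) (f∈ J)

    -- The lattice structure inherited from the product of chains.

    coord-injective : ∀ O O′ → (∀ J → coord O J ≡ coord O′ J) → _≈_ ℐ O O′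
    coord-injective O O′ eq = ⊑-antisym {O} {O′}
      (coord-reflects O O′ λ J → ℕ.≤-reflexive (cong toℕ (eq J)))
      (coord-reflects O′ O λ J → ℕ.≤-reflexive (cong toℕ (sym (eq J))))

    open import Algebra.Construct.NaturalChoice.Max (≤-totalOrder n) as Max using (_⊔_)
    open import Algebra.Construct.NaturalChoice.Min (≤-totalOrder n) as Min using (_⊓_)
    open import Algebra.Construct.NaturalChoice.MinMaxOp Min.minOperator Max.maxOperator using (⊓-distribˡ-⊔)

    coord-admissible : ∀ O J → Admissible J (coord O J)
    coord-admissible O J = rep-admissible J (target-∈ O J)

    private
      select : ∀ {J x y z} → z ≡ x ⊎ z ≡ y → Admissible J x → Admissible J y → Admissible J z
      select (inj₁ refl) x-adm _ = x-adm
      select (inj₂ refl) _ y-adm = y-adm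

      join-admissible : ∀ O O′ J → Admissible J (coord O J ⊔ coord O′ J)
      join-admissible O O′ J =
        -- In a chain the maximum is one of its two arguments, so it is again the least element of a
        -- class.
        select {J} (Max.⊔-sel (coord O J) (coord O′ J)) (coord-admissible O J) (coord-admissible O′ J)

      meet-admissible : ∀ O O′ J → Admissible J (coord O J ⊓ coord O′ J)
      meet-admissible O O′ J =
        select {J} (Min.⊓-sel (coord O J) (coord O′ J)) (coord-admissible O J) (coord-admissible O′ J)

    infixr 6 _∨_
    infixr 7 _∧_

    _∨_ _∧_ : AO → AO → AO
    O ∨ O′ = realise _ (join-admissible O O′)
    O ∧ O′ = realise _ (meet-admissible O O′)

    coord-∨ : ∀ O O′ J → coord (O ∨ O′) J ≡ coord O J ⊔ coord O′ J
    coord-∨ O O′ = coord-realise _ (join-admissible O O′)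

    coord-∧ : ∀ O O′ J → coord (O ∧ O′) J ≡ coord O J ⊓ coord O′ J
    coord-∧ O O′ = coord-realise _ (meet-admissible O O′)

    coord⇒≤ᴾ : ∀ O O′ → (∀ J → coord O J ≤ coord O′ J) → _≤ᴾ_ ℐ O O′
    coord⇒≤ᴾ O O′ = ⊑⇒≤ᴾ {O} {O′} ∘ coord-reflects O O′

    ≤ᴾ⇒coord : ∀ O O′ → _≤ᴾ_ ℐ O O′ → ∀ J → coord O J ≤ coord O′ J
    ≤ᴾ⇒coord O O′ = coord-mono O O′ ∘ ≤ᴾ⇒⊑

    ≤ᴾ-isPartialOrder : IsPartialOrder (_≈_ ℐ) (_≤ᴾ_ ℐ)
    ≤ᴾ-isPartialOrder = record
      { isPreorder = record
        { isEquivalence = record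
          { refl  = λ _ → refl
          ; sym   = λ O≈O′ H → sym (O≈O′ H)
          ; trans = λ O≈O′ O′≈O″ H → trans (O≈O′ H) (O′≈O″ H)
          }
        ; reflexive = inj₂
        ; trans     = λ {O} {O′} {O″} O≤O′ O′≤O″ →
            ⊑⇒≤ᴾ {O} {O″} λ H → ℕ.≤-trans (≤ᴾ⇒⊑ O≤O′ H) (≤ᴾ⇒⊑ O′≤O″ H)
        }
      ; antisym = λ {O} {O′} O≤O′ O′≤O → ⊑-antisym {O} {O′} (≤ᴾ⇒⊑ O≤O′) (≤ᴾ⇒⊑ O′≤O)
      }

    intersectionCondition⇒distributive : IsDistributiveLattice (_≈_ ℐ) (_≤ᴾ_ ℐ) _∨_ _∧_
    intersectionCondition⇒distributive = record
      { isLattice = record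
        { isPartialOrder = ≤ᴾ-isPartialOrder
        ; supremum = λ O O′ →
            coord⇒≤ᴾ O (O ∨ O′) (λ J → subst (coord O J ≤_) (sym (coord-∨ O O′ J)) (Max.x≤x⊔y (coord O J) (coord O′ J))) ,
            coord⇒≤ᴾ O′ (O ∨ O′) (λ J → subst (coord O′ J ≤_) (sym (coord-∨ O O′ J)) (Max.x≤y⊔x (coord O J) (coord O′ J))) ,
            λ U O≤U O′≤U → coord⇒≤ᴾ (O ∨ O′) U λ J → subst (_≤ coord U J) (sym (coord-∨ O O′ J))
              (Max.⊔-lub {coord U J} {coord O J} {coord O′ J} (≤ᴾ⇒coord O U O≤U J) (≤ᴾ⇒coord O′ U O′≤U J))
        ; infimum = λ O O′ →
            coord⇒≤ᴾ (O ∧ O′) O (λ J → subst (_≤ coord O J) (sym (coord-∧ O O′ J)) (Min.x⊓y≤x (coord O J) (coord O′ J))) ,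
            coord⇒≤ᴾ (O ∧ O′) O′ (λ J → subst (_≤ coord O′ J) (sym (coord-∧ O O′ J)) (Min.x⊓y≤y (coord O J) (coord O′ J))) ,
            λ L L≤O L≤O′ → coord⇒≤ᴾ L (O ∧ O′) λ J → subst (coord L J ≤_) (sym (coord-∧ O O′ J))
              (Min.⊓-glb {coord L J} {coord O J} {coord O′ J} (≤ᴾ⇒coord L O L≤O J) (≤ᴾ⇒coord L O′ L≤O′ J))
        }
      ; ∧-distribˡ-∨ = λ O P Q → coord-injective (O ∧ (P ∨ Q)) ((O ∧ P) ∨ (O ∧ Q)) λ J → begin
          coord (O ∧ (P ∨ Q)) J                                  ≡⟨ coord-∧ O (P ∨ Q) J ⟩
          coord O J ⊓ coord (P ∨ Q) J                            ≡⟨ cong (coord O J ⊓_) (coord-∨ P Q J) ⟩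
          coord O J ⊓ (coord P J ⊔ coord Q J)                    ≡⟨ ⊓-distribˡ-⊔ (coord O J) (coord P J) (coord Q J) ⟩
          (coord O J ⊓ coord P J) ⊔ (coord O J ⊓ coord Q J)      ≡⟨ cong₂ _⊔_ (coord-∧ O P J) (coord-∧ O Q J) ⟨
          coord (O ∧ P) J ⊔ coord (O ∧ Q) J                      ≡⟨ coord-∨ (O ∧ P) (O ∧ Q) J ⟨
          coord ((O ∧ P) ∨ (O ∧ Q)) J                            ∎
      }
      where open ≡-Reasoning

theoremB : (n : ℕ) → n ≥ 1 → (ℐ : Hypergraph n) → IsIntervalHypergraph ℐ →
    HypergraphicPosetIsDistributiveLattice ℐ ⇔ IntersectionCondition ℐ
theoremB n _ ℐ intervals = mk⇔
  (λ (_ , _ , isDL) → distributive⇒intersectionCondition isDL) condition⇒lattice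
  where
  open Intervals ℐ intervals
  condition⇒lattice : IntersectionCondition ℐ → HypergraphicPosetIsDistributiveLattice ℐ
  condition⇒lattice cond = _∨_ cond , _∧_ cond , intersectionCondition⇒distributive cond
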